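{- Let $F=\bigwedge_{i=1}^P F_i$ be a CNF formula partitioned into sub-formulas, and let $G$ be the graph with tables obtained from this partition by the initial construction followed by a finite sequence of Marginalize, Reduce and Merge operations (as described in the context). Suppose $G$ is a tree, choose a root vertex $r$, and run the message passing algorithm described in the context on the rooted tree $G$. On termination, $$\text{sat-count}(F)=\sum_{s\in T(X_r)}c(s),$$ where $T(X_r)$ is the table at the root vertex $r$ on termination, and the sum is over its entries $s$ with counts $c(s)$.
   Context: For a formula $F$ over a finite set of Boolean variables, $\text{sat-count}(F)$ is the number of its satisfying assignments. Tables. A table $T(X)$ over a finite set $X$ of Boolean variables is a finite set of entries $(S,c(S))$, $S$ an assignment of $X$ and $c(S)$ a positive count; unlisted assignments have count $0$. Marginalizing a set $Z\subseteq X$ in $T(X)$ gives the table over $X\setminus Z$ in which the count of an assignment is the sum of the counts in $T(X)$ of all its extensions to $X$ (only nonzero counts stored). The factor product of tables $T_1(X_1)$ and $T_2(X_2)$ is the table over $X_1\cup X_2$ in which an assignment has count equal to the product of the counts of its restrictions to $X_1$ in $T_1$ and to $X_2$ in $T_2$ (only nonzero counts stored). Initial construction. The clauses of $F$ are partitioned into sub-formulas $F_1,\dots,F_P$; $X_i$ is the set of variables occurring in $F_i$, and $\bigcup_i X_i$ is the set of all variables of $F$. The graph $G$ has one vertex $V_i$ for each $i$, carrying $X_i$ and the table $T_i(X_i)$ that lists the satisfying assignments of $F_i$ over $X_i$, each with count $1$. Distinct vertices $V_i,V_j$ are joined by an edge if and only if $X_i\cap X_j\neq\emptyset$. Operations.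 Marginalize: a variable belonging to the variable set of exactly one vertex $V_i$ is marginalized in $T_i$ and removed from $X_i$ (certain designated variables, the error bits, are never marginalized). Reduce: repeatedly, for adjacent $V_i,V_j$, delete from each of the two tables all entries whose restriction to $X_i\cap X_j$ is not the restriction of some entry of the other table, until no deletion is possible for any edge or some table is empty (in which case $F$ is reported unsatisfiable). Merge$(V_i,V_j)$ for adjacent $V_i,V_j$: remove $V_j$, connect all its neighbours to $V_i$, replace $T_i$ by the factor product of $T_i$ and $T_j$, and replace $X_i$ by $X_i\cup X_j$. Message passing on the rooted tree $G$ with root $r$. Vertices are processed from the leaves towards the root, each non-root vertex being processed once it has received messages from all its children (leaves immediately). When a non-root vertex $v$ with parent $u$ is processed, the message $m_{v\to u}$ is obtained by marginalizing the variables $X_v\setminus X_u$ in the current table of $v$ (which already incorporates the messages from the children of $v$); then the table of $u$ is replaced by the factor product of the table of $u$ and $m_{v\to u}$. The algorithm terminates when the root has received the messages from all its children. If $r$ is the only vertex, no messages are passed. -}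

module Defs where

open import Data.Bool.Base using (Bool; true; false; if_then_else_)
import Data.Bool.Properties as Bool
open import Data.Empty using (⊥-elim-irr)
open import Data.Fin.Base using (Fin; zero; suc)
open import Data.Fin.Subset
open import Data.Fin.Subset.Properties
  using (p⊆p∪q; q⊆p∪q; p∩q⊆p; p∩q⊆q; p─q⊆p; drop-∷-⊆)
open import Data.List.Base
  using (List; []; _∷_; _++_; map; concat; filter; length; last; _∷ʳ_; tabulate)
open import Data.List.Relation.Binary.Permutation.Propositional using (_↭_)
open import Data.List.Relation.Unary.All using (All; all?)
open import Data.List.Relation.Unary.Any using (Any; any?)
open import Data.List.Relation.Unary.Linked using (Linked)
open import Data.List.Relation.Unary.Unique.Propositional using (Unique)
open import Data.Maybe.Base using (Maybe; just; nothing)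
import Data.Maybe.Properties as Maybe
open import Data.Nat.Base using (ℕ; _*_; _≤_)
open import Data.Nat.ListAction using (sum)
import Data.Nat.Properties as ℕ
open import Data.Product.Base using (_×_; _,_; proj₁; ∃-syntax)
open import Data.Sum.Base using (_⊎_)
open import Data.Vec.Base using ([]; _∷_; here)
open import Data.Vec.Functional using (Vector; updateAt)
open import Function.Base using (_∘_)
open import Level using (0ℓ) renaming (suc to lsuc)
open import Relation.Binary.Construct.Closure.ReflexiveTransitive using (Star)
open import Relation.Binary.Core using (Rel)
open import Relation.Binary.Definitions using (DecidableEquality)
open import Relation.Binary.PropositionalEquality using (_≡_; _≢_; refl; cong)
open import Relation.Nullary.Decidable using (Dec; yes; no; does; map′; ¬?)
open import Relation.Nullary.Negation using (¬_)

private
  variable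
    n P : ℕ

-- The assignments of X.  Variables outside X carry no value, so
-- propositional equality is equality of assignments.
data Assignment : Subset n → Set where
  []   : Assignment []
  _∷_  : {X : Subset n} → Bool → Assignment X → Assignment (inside ∷ X)
  skip : {X : Subset n} → Assignment X → Assignment (outside ∷ X)

assignments : (X : Subset n) → List (Assignment X)
assignments []            = [] ∷ []
assignments (outside ∷ X) = map skip (assignments X)
assignments (inside  ∷ X) =
  map (false ∷_) (assignments X) ++ map (true ∷_) (assignments X)

value : {X : Subset n} → Assignment X → Fin n → Maybe Bool
value []       ()
value (b ∷ S)  zero    = just b
value (b ∷ S)  (suc x) = value S x
value (skip S) zero    = nothing
value (skip S) (suc x) = value S x

restrict : {Y X : Subset n} → .(Y ⊆ X) → Assignment X → Assignment Y
restrict {Y = []}          {X = []}          Y⊆X []       = []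
restrict {Y = inside  ∷ _} {X = inside  ∷ _} Y⊆X (b ∷ S)  =
  b ∷ restrict (drop-∷-⊆ Y⊆X) S
restrict {Y = outside ∷ _} {X = inside  ∷ _} Y⊆X (b ∷ S)  =
  skip (restrict (drop-∷-⊆ Y⊆X) S)
restrict {Y = inside  ∷ _} {X = outside ∷ _} Y⊆X (skip S) =
  ⊥-elim-irr (zero∉ (Y⊆X here))
  where
  zero∉ : ∀ {n} {p : Subset n} → zero ∉ outside ∷ p
  zero∉ ()
restrict {Y = outside ∷ _} {X = outside ∷ _} Y⊆X (skip S) =
  skip (restrict (drop-∷-⊆ Y⊆X) S)

infix 4 _≟_

_≟_ : {X : Subset n} → DecidableEquality (Assignment X)
[]      ≟ []       = yes refl
skip S  ≟ skip S′  = map′ (cong skip) (λ { refl → refl }) (S ≟ S′)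
(b ∷ S) ≟ (b′ ∷ S′) with b Bool.≟ b′ | S ≟ S′
... | yes refl | yes refl = yes refl
... | no  b≢b′ | _        = no λ { refl → b≢b′ refl }
... | yes _    | no  S≢S′ = no λ { refl → S≢S′ refl }

-- (x , true) is the literal x and (x , false) is its negation.
Literal : ℕ → Set
Literal n = Fin n × Bool

Clause : ℕ → Set
Clause n = List (Literal n)

CNF : ℕ → Set
CNF n = List (Clause n)

vars : CNF n → Subset n
vars F = ⋃ (map (⁅_⁆ ∘ proj₁) (concat F))

LiteralTrue : {X : Subset n} → Assignment X → Literal n → Set
LiteralTrue S (x , b) = value S x ≡ just b

-- Only used when vars F ⊆ X, so that every literal of F has a value.
Satisfies : {X : Subset n} → CNF n → Assignment X → Set
Satisfies F S = All (Any (LiteralTrue S)) F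

satisfies? : {X : Subset n} (F : CNF n) (S : Assignment X) → Dec (Satisfies F S)
satisfies? F S =
  all? (any? λ (x , b) → Maybe.≡-dec Bool._≟_ (value S x) (just b)) F

satCount : CNF n → ℕ
satCount F = length (filter (satisfies? F) (assignments (vars F)))

PartitionedInto : CNF n → Vector (CNF n) P → Set
PartitionedInto F parts = concat (tabulate parts) ↭ F

-- A table is given by its count function.  Its entries are the
-- assignments with nonzero count.
record Table (n : ℕ) : Set where
  constructor table
  field
    scope : Subset n
    count : Assignment scope → ℕ

  entries : List (Assignment scope)
  entries = filter (λ S → ¬? (count S ℕ.≟ 0)) (assignments scope)

open Table public

marginalize : Subset n → Table n → Table n
marginalize Z T = table (scope T ─ Z) λ S →
  sum (map (count T)
    (filter (λ S′ → restrict (p─q⊆p (scope T) Z) S′ ≟ S) (assignments (scope T))))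

infixl 7 _⊗_

_⊗_ : Table n → Table n → Table n
T₁ ⊗ T₂ = table (scope T₁ ∪ scope T₂) λ S →
  count T₁ (restrict (p⊆p∪q (scope T₂)) S) *
  count T₂ (restrict (q⊆p∪q (scope T₁) (scope T₂)) S)

AgreeOn∩ : {X Y : Subset n} → Assignment X → Assignment Y → Set
AgreeOn∩ {X = X} {Y = Y} S S′ = restrict (p∩q⊆p X Y) S ≡ restrict (p∩q⊆q X Y) S′

Matched : (T₁ T₂ : Table n) → Assignment (scope T₁) → Set
Matched T₁ T₂ S = Any (AgreeOn∩ S) (entries T₂)

matched? : (T₁ T₂ : Table n) (S : Assignment (scope T₁)) → Dec (Matched T₁ T₂ S)
matched? T₁ T₂ S = any? (λ _ → _ ≟ _) (entries T₂)

infixl 7 _⋉_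

-- T₁ without the entries that no entry of T₂ agrees with.
_⋉_ : Table n → Table n → Table n
T₁ ⋉ T₂ = table (scope T₁) λ S →
  if does (matched? T₁ T₂ S) then count T₁ S else 0

-- Vertices are named by Fin P; a merged vertex leaves the set
-- `vertices`, and its name (with a stale table) is from then on unused.
-- The variable set X_i of the vertex i is scope (tables i).
record Graph (n P : ℕ) : Set₁ where
  field
    vertices : Subset P
    tables   : Vector (Table n) P
    Adjacent : Rel (Fin P) 0ℓ

open Graph public

initialTable : CNF n → Table n
initialTable F = table (vars F) λ S → if does (satisfies? F S) then 1 else 0

initial : Vector (CNF n) P → Graph n P
initial parts = record
  { vertices = ⊤
  ; tables   = initialTable ∘ parts
  ; Adjacent = λ i j → i ≢ j × Nonempty (vars (parts i) ∩ vars (parts j))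
  }

marginalizeAt : Fin P → Fin n → Graph n P → Graph n P
marginalizeAt i x G = record G
  { tables = updateAt (tables G) i (marginalize ⁅ x ⁆) }

-- Both tables are filtered against each other's previous contents.
deleteUnmatched : Fin P → Fin P → Graph n P → Graph n P
deleteUnmatched i j G = record G
  { tables = updateAt (updateAt (tables G) i (_⋉ tables G j)) j (_⋉ tables G i) }

NoDeletionPossible : Graph n P → Set
NoDeletionPossible G = ∀ {i j} → Adjacent G i j →
  All (Matched (tables G i) (tables G j)) (entries (tables G i))

SomeTableEmpty : Graph n P → Set
SomeTableEmpty G = ∃[ i ] i ∈ vertices G × entries (tables G i) ≡ []

ReductionOver : Graph n P → Set
ReductionOver G = NoDeletionPossible G ⊎ SomeTableEmpty G

data Reduces {n P : ℕ} : Rel (Graph n P) (lsuc 0ℓ) where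
  stop : ∀ {G} → ReductionOver G → Reduces G G
  step : ∀ {G G′ i j} → ¬ ReductionOver G → Adjacent G i j →
         Reduces (deleteUnmatched i j G) G′ → Reduces G G′

mergeVertices : Fin P → Fin P → Graph n P → Graph n P
mergeVertices i j G = record
  { vertices = vertices G - j
  ; tables   = updateAt (tables G) i (_⊗ tables G j)
  ; Adjacent = λ a b → a ≢ b × a ≢ j × b ≢ j ×
      (Adjacent G a b ⊎ (a ≡ i × Adjacent G j b) ⊎ (b ≡ i × Adjacent G a j))
  }

-- One operation, where the variables in E (the error bits) are never
-- marginalized.
data Operation {n P : ℕ} (E : Subset n) : Rel (Graph n P) (lsuc 0ℓ) where
  marginalizeOp : ∀ {G i x} → x ∉ E → i ∈ vertices G → x ∈ scope (tables G i) →
    (∀ {j} → j ∈ vertices G → x ∈ scope (tables G j) → j ≡ i) →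
    Operation E G (marginalizeAt i x G)
  reduceOp : ∀ {G G′} → Reduces G G′ → Operation E G G′
  mergeOp  : ∀ {G i j} → Adjacent G i j → Operation E G (mergeVertices i j G)

Operations : Subset n → Rel (Graph n P) (lsuc 0ℓ)
Operations E = Star (Operation E)

Connected : Graph n P → Set
Connected G = ∀ {u v} → u ∈ vertices G → v ∈ vertices G → Star (Adjacent G) u v

-- The closed walk v, w₁, …, wₖ, v is a cycle.
IsCycle : Graph n P → Fin P → List (Fin P) → Set
IsCycle G v ws =
  2 ≤ length ws × Unique (v ∷ ws) × Linked (Adjacent G) (v ∷ ws ∷ʳ v)

record IsTree (G : Graph n P) : Set where
  field
    nonempty  : Nonempty (vertices G)
    connected : Connected G
    acyclic   : ∀ v ws → ¬ IsCycle G v ws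

-- u is the parent of v: a simple path from v to the root r starts with
-- the edge from v to u.
Parent : Graph n P → (r v u : Fin P) → Set
Parent G r v u = ∃[ ws ]
  Linked (Adjacent G) (v ∷ u ∷ ws) × Unique (v ∷ u ∷ ws) × last (u ∷ ws) ≡ just r

record MessageState (n P : ℕ) : Set where
  constructor state
  field
    processed : Subset P
    current   : Vector (Table n) P

open MessageState public

message : Table n → Table n → Table n
message Tᵥ Tᵤ = marginalize (scope Tᵥ ─ scope Tᵤ) Tᵥ

ReceivedAll : Graph n P → (r v : Fin P) → MessageState n P → Set
ReceivedAll G r v σ = ∀ {w} → Parent G r w v → w ∈ processed σ

-- That v is not the root follows from its having a parent.
data Process (G : Graph n P) (r : Fin P) : Rel (MessageState n P) 0ℓ where
  process : ∀ {σ v u} → Parent G r v u → v ∉ processed σ → ReceivedAll G r v σ →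
    Process G r σ
      (state (processed σ ∪ ⁅ v ⁆)
             (updateAt (current σ) u (_⊗ message (current σ v) (current σ u))))

-- A run of the algorithm, in any order of processing, that ends in σ.
TerminatesIn : Graph n P → Fin P → MessageState n P → Set
TerminatesIn G r σ = Star (Process G r) (state ⊥ (tables G)) σ × ReceivedAll G r r σ

{-# OPTIONS --safe #-}

-- A table T is read as a weight on the valuations of all n variables, namely
-- the count of the restriction to the scope of T.  Factor products become
-- pointwise products, and marginalizing Z becomes the operator ∑ Z.  The
-- invariant is that summing the product of all tables over the union of the
-- scopes gives the number of satisfying assignments.  It is preserved by
-- eliminating a variable that occurs in a single table, because the other
-- factors can be pulled out of the sum, and by deleting an unmatched entry,
-- because every product that it contributes to is already zero.
--
-- The edges always join exactly the vertices that share a variable.  In a tree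
-- a neighbour of v is its parent or one of its children, so when v sends its
-- message the variables that it does not share with its parent occur in no
-- other unprocessed vertex, and v can be dropped from the product.
module Submission where

open import Defs
open import Algebra.Properties.CommutativeSemigroup using (interchange)
open import Data.Bool.Base using (Bool; true; false; if_then_else_)
import Data.Bool.Properties as Bool
open import Data.Empty using (⊥-elim-irr)
open import Data.Fin.Base using (Fin; zero; suc)
import Data.Fin.Properties as Fin
open import Data.Fin.Subset
  using (Subset; inside; outside; _∈_; _∉_; _⊆_; _∩_; _∪_; _─_; _-_; ⁅_⁆; ⋃; ⊤; ⊥)
open import Data.Fin.Subset.Properties
open import Data.List.Base
  using (List; []; _∷_; _++_; _∷ʳ_; map; filter; last; length; tabulate)
open import Data.List.Membership.Propositional using (find; lose) renaming (_∈_ to _∈ₗ_)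
open import Data.List.Membership.Propositional.Properties
  using (∈-map⁺; ∈-map⁻; ∈-++⁺ˡ; ∈-++⁺ʳ; ∈-filter⁺; ∈-concat⁺′; ∈-concat⁻′;
         ∈-tabulate⁺; ∈-tabulate⁻)
import Data.List.Properties as List
open import Data.List.Relation.Binary.Permutation.Propositional using (↭-sym)
open import Data.List.Relation.Binary.Permutation.Propositional.Properties
  using (All-resp-↭; Any-resp-↭)
open import Data.List.Relation.Unary.All as All using (All; []; _∷_)
import Data.List.Relation.Unary.All.Properties as All
open import Data.List.Relation.Unary.AllPairs using ([]; _∷_)
open import Data.List.Relation.Unary.Any as Any using (Any; here; there)
open import Data.List.Relation.Unary.Linked using (Linked; [-]; _∷_)
open import Data.List.Relation.Unary.Unique.Propositional using (Unique)
open import Data.Maybe.Base using (just)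
open import Data.Maybe.Properties using (just-injective)
open import Data.Nat.Base using (ℕ; zero; suc; _+_; _*_; _≤_; z≤n; s≤s)
open import Data.Nat.ListAction using (sum)
open import Data.Nat.ListAction.Properties using (sum-++)
import Data.Nat.Properties as ℕ
open import Data.Product.Base using (_×_; _,_; proj₁; proj₂; ∃-syntax)
open import Data.Sum.Base using (_⊎_; inj₁; inj₂; [_,_]′)
open import Data.Vec.Base using (Vec; []; _∷_; lookup; replicate; here; there)
open import Data.Vec.Functional using (Vector; updateAt)
open import Data.Vec.Functional.Properties using (updateAt-updates; updateAt-minimal)
open import Function.Base using (_∘_; id)
open import Relation.Binary.Construct.Closure.ReflexiveTransitive using (Star; ε; _◅_)
open import Relation.Binary.PropositionalEquality
  using (_≡_; _≢_; refl; sym; trans; cong; cong₂; subst; _≗_; module ≡-Reasoning)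
open import Relation.Nullary.Decidable using (does; yes; no; ¬?; dec-true; dec-false)
open import Relation.Nullary.Negation using (¬_; contradiction)
open import Relation.Unary using (Decidable)

open ≡-Reasoning

private
  variable
    n P : ℕ

-- Membership in differences of subsets.

x∈p─q⇒x∉q : ∀ (p q : Subset n) {x} → x ∈ p ─ q → x ∉ q
x∈p─q⇒x∉q (s ∷ p) (inside  ∷ q) {zero}  ()
x∈p─q⇒x∉q (s ∷ p) (outside ∷ q) {zero}  _         ()
x∈p─q⇒x∉q (s ∷ p) (t       ∷ q) {suc x} (there m) (there m′) = x∈p─q⇒x∉q p q m m′

x∈p-y⇒x≢y : ∀ (p : Subset n) {x y} → x ∈ p - y → x ≢ y
x∈p-y⇒x≢y p {y = y} x∈p-y refl = x∈p─q⇒x∉q p ⁅ y ⁆ x∈p-y (x∈⁅x⁆ y)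

-- Weights on valuations and summation over a set of variables.

Weight : ℕ → Set
Weight n = Vec Bool n → ℕ

-- ∑ Z f w sums f over all ways of overwriting w on Z.
∑ : Subset n → Weight n → Weight n
∑ []            f []      = f []
∑ (outside ∷ Z) f (b ∷ w) = ∑ Z (f ∘ (b ∷_)) w
∑ (inside  ∷ Z) f (b ∷ w) = ∑ Z (f ∘ (false ∷_)) w + ∑ Z (f ∘ (true ∷_)) w

∑-cong : ∀ (Z : Subset n) {f g : Weight n} → f ≗ g → ∑ Z f ≗ ∑ Z g
∑-cong []            f≗g []      = f≗g []
∑-cong (outside ∷ Z) f≗g (b ∷ w) = ∑-cong Z (f≗g ∘ (b ∷_)) w
∑-cong (inside  ∷ Z) f≗g (b ∷ w) =
  cong₂ _+_ (∑-cong Z (f≗g ∘ (false ∷_)) w) (∑-cong Z (f≗g ∘ (true ∷_)) w)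

∑-+ : ∀ (Z : Subset n) (f g : Weight n) w →
      ∑ Z (λ w → f w + g w) w ≡ ∑ Z f w + ∑ Z g w
∑-+ []            f g []      = refl
∑-+ (outside ∷ Z) f g (b ∷ w) = ∑-+ Z (f ∘ (b ∷_)) (g ∘ (b ∷_)) w
∑-+ (inside  ∷ Z) f g (b ∷ w) = trans
  (cong₂ _+_ (∑-+ Z (f ∘ (false ∷_)) (g ∘ (false ∷_)) w)
             (∑-+ Z (f ∘ (true ∷_)) (g ∘ (true ∷_)) w))
  (interchange ℕ.+-commutativeSemigroup (∑ Z (f ∘ (false ∷_)) w) _ _ _)

-- Disjointness matters: a variable in both sets would be summed once on the left but twice on the
-- right, where the outer sum runs over a function constant in it and doubles the value.
∑-∪ : ∀ (U Z : Subset n) → (∀ {x} → x ∈ U → x ∉ Z) → (f : Weight n) →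
      ∑ (U ∪ Z) f ≗ ∑ U (∑ Z f)
∑-∪ []            []            _   f []      = refl
∑-∪ (outside ∷ U) (outside ∷ Z) U∥Z f (b ∷ w) =
  ∑-∪ U Z (λ x∈U x∈Z → U∥Z (there x∈U) (there x∈Z)) (f ∘ (b ∷_)) w
∑-∪ (inside  ∷ U) (outside ∷ Z) U∥Z f (b ∷ w) = cong₂ _+_ (rec false) (rec true)
  where
  rec : ∀ c → ∑ (U ∪ Z) (f ∘ (c ∷_)) w ≡ ∑ U (∑ Z (f ∘ (c ∷_))) w
  rec c = ∑-∪ U Z (λ x∈U x∈Z → U∥Z (there x∈U) (there x∈Z)) (f ∘ (c ∷_)) w
∑-∪ (outside ∷ U) (inside  ∷ Z) U∥Z f (b ∷ w) =
  trans (cong₂ _+_ (rec false) (rec true)) (sym (∑-+ U _ _ w))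
  where
  rec : ∀ c → ∑ (U ∪ Z) (f ∘ (c ∷_)) w ≡ ∑ U (∑ Z (f ∘ (c ∷_))) w
  rec c = ∑-∪ U Z (λ x∈U x∈Z → U∥Z (there x∈U) (there x∈Z)) (f ∘ (c ∷_)) w
∑-∪ (inside  ∷ U) (inside  ∷ Z) U∥Z f (b ∷ w) = contradiction here (U∥Z here)

IndependentOf : Subset n → Weight n → Set
IndependentOf Z f =
  ∀ w w′ → (∀ {x} → x ∉ Z → lookup w x ≡ lookup w′ x) → f w ≡ f w′

independent-∷ : ∀ {s} {Z : Subset n} {f} → IndependentOf (s ∷ Z) f →
                ∀ b → IndependentOf Z (f ∘ (b ∷_))
independent-∷ {s = s} {Z} indep b w w′ w≈w′ = indep (b ∷ w) (b ∷ w′) agree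
  where
  agree : ∀ {x} → x ∉ s ∷ Z → lookup (b ∷ w) x ≡ lookup (b ∷ w′) x
  agree {zero}  _   = refl
  agree {suc x} x∉Z = w≈w′ (x∉Z ∘ there)

-- All valuations visited by the sum agree with `w` outside `Z`, so `f` has one value on them and
-- comes out by distributivity.
∑-*ˡ : ∀ (Z : Subset n) {f : Weight n} → IndependentOf Z f → (g : Weight n) →
       ∀ w → ∑ Z (λ w → f w * g w) w ≡ f w * ∑ Z g w
∑-*ˡ []            indep g []          = refl
∑-*ˡ (outside ∷ Z) indep g (b ∷ w)     = ∑-*ˡ Z (independent-∷ indep b) (g ∘ (b ∷_)) w
∑-*ˡ (inside  ∷ Z) {f} indep g (b ∷ w) =
  trans (cong₂ _+_ (rec false) (rec true)) (sym (ℕ.*-distribˡ-+ (f (b ∷ w)) _ _))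
  where
  agree : ∀ c {x} → x ∉ inside ∷ Z → lookup (c ∷ w) x ≡ lookup (b ∷ w) x
  agree c {zero}  0∉Z = contradiction here 0∉Z
  agree c {suc x} _   = refl

  rec : ∀ c → ∑ Z (λ w → f (c ∷ w) * g (c ∷ w)) w ≡ f (b ∷ w) * ∑ Z (g ∘ (c ∷_)) w
  rec c = trans (∑-*ˡ Z (independent-∷ indep c) (g ∘ (c ∷_)) w)
                (cong (_* _) (indep (c ∷ w) (b ∷ w) (agree c)))

-- Variable elimination, the common core of Marginalize and of message passing. There `g` is the
-- table in which `Z` is summed out, and `f` is the product of the remaining tables.
∑-eliminate : ∀ (U Z : Subset n) → (∀ {x} → x ∈ U → x ∉ Z) →
  {f : Weight n} → IndependentOf Z f → (g : Weight n) →
  ∀ w → ∑ (U ∪ Z) (λ w → f w * g w) w ≡ ∑ U (λ w → f w * ∑ Z g w) w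
∑-eliminate U Z U∥Z {f} indep g w = trans (∑-∪ U Z U∥Z _ w) (∑-cong U (∑-*ˡ Z indep g) w)

-- Products over sets of vertices.

∏ : Subset P → (Fin P → ℕ) → ℕ
∏ []            f = 1
∏ (outside ∷ R) f = ∏ R (f ∘ suc)
∏ (inside  ∷ R) f = f zero * ∏ R (f ∘ suc)

∏-cong : ∀ (R : Subset P) {f g} → (∀ {i} → i ∈ R → f i ≡ g i) → ∏ R f ≡ ∏ R g
∏-cong []            f≗g = refl
∏-cong (outside ∷ R) f≗g = ∏-cong R (f≗g ∘ there)
∏-cong (inside  ∷ R) f≗g = cong₂ _*_ (f≗g here) (∏-cong R (f≗g ∘ there))

∏-extract : ∀ {R : Subset P} {i} → i ∈ R → ∀ f → ∏ R f ≡ ∏ (R - i) f * f i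
∏-extract {R = inside ∷ R} here f = trans (ℕ.*-comm (f zero) _)
  (cong (λ S → ∏ S (f ∘ suc) * f zero) (sym (p─⊥≡p R)))
∏-extract {R = outside ∷ R} (there i∈R) f = ∏-extract i∈R (f ∘ suc)
∏-extract {R = inside  ∷ R} (there i∈R) f =
  trans (cong (f zero *_) (∏-extract i∈R (f ∘ suc))) (sym (ℕ.*-assoc (f zero) _ _))

∏-extract₂ : ∀ {R : Subset P} {i j} → i ∈ R → j ∈ R → j ≢ i → ∀ f →
             ∏ R f ≡ ∏ (R - i - j) f * (f i * f j)
∏-extract₂ {R = R} {i} {j} i∈R j∈R j≢i f = begin
  ∏ R f                           ≡⟨ ∏-extract i∈R f ⟩
  ∏ (R - i) f * f i               ≡⟨ cong (_* f i) (∏-extract (x∈p∧x≢y⇒x∈p-y j∈R j≢i) f) ⟩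
  ∏ (R - i - j) f * f j * f i     ≡⟨ ℕ.*-assoc (∏ (R - i - j) f) (f j) (f i) ⟩
  ∏ (R - i - j) f * (f j * f i)   ≡⟨ cong (∏ (R - i - j) f *_) (ℕ.*-comm (f j) (f i)) ⟩
  ∏ (R - i - j) f * (f i * f j)   ∎

∏-one : ∀ (R : Subset P) {f} → (∀ {i} → i ∈ R → f i ≡ 1) → ∏ R f ≡ 1
∏-one []            f≡1 = refl
∏-one (outside ∷ R) f≡1 = ∏-one R (f≡1 ∘ there)
∏-one (inside  ∷ R) f≡1 = cong₂ _*_ (f≡1 here) (∏-one R (f≡1 ∘ there))

∏-zero : ∀ {R : Subset P} {f i} → i ∈ R → f i ≡ 0 → ∏ R f ≡ 0
∏-zero {R = R} {f} {i} i∈R fi≡0 =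
  trans (∏-extract i∈R f) (trans (cong (∏ (R - i) f *_) fi≡0) (ℕ.*-zeroʳ (∏ (R - i) f)))

-- Assignments induced by total valuations.

assign : (X : Subset n) → Vec Bool n → Assignment X
assign []            []      = []
assign (inside  ∷ X) (b ∷ w) = b ∷ assign X w
assign (outside ∷ X) (b ∷ w) = skip (assign X w)

assign-cong : ∀ (X : Subset n) {w w′} → (∀ {x} → x ∈ X → lookup w x ≡ lookup w′ x) →
              assign X w ≡ assign X w′
assign-cong []            {[]}    {[]}     w≈w′ = refl
assign-cong (inside  ∷ X) {b ∷ w} {c ∷ w′} w≈w′ =
  cong₂ _∷_ (w≈w′ here) (assign-cong X (w≈w′ ∘ there))
assign-cong (outside ∷ X) {b ∷ w} {c ∷ w′} w≈w′ = cong skip (assign-cong X (w≈w′ ∘ there))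

-- This is what makes valuations convenient: assignments induced by one valuation on different
-- scopes are automatically compatible, so factor products and agreement on overlaps need no further
-- bookkeeping.
restrict-assign : ∀ (Y X : Subset n) .(Y⊆X : Y ⊆ X) w → restrict Y⊆X (assign X w) ≡ assign Y w
restrict-assign []            []            Y⊆X []      = refl
restrict-assign (inside  ∷ Y) (inside  ∷ X) Y⊆X (b ∷ w) = cong (b ∷_) (restrict-assign Y X _ w)
restrict-assign (outside ∷ Y) (inside  ∷ X) Y⊆X (b ∷ w) = cong skip (restrict-assign Y X _ w)
restrict-assign (inside  ∷ Y) (outside ∷ X) Y⊆X (b ∷ w) = ⊥-elim-irr (zero∉ (Y⊆X here))
  where
  zero∉ : zero ∉ outside ∷ X
  zero∉ ()
restrict-assign (outside ∷ Y) (outside ∷ X) Y⊆X (b ∷ w) = cong skip (restrict-assign Y X _ w)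

value-assign⁺ : ∀ {X : Subset n} {x} → x ∈ X → ∀ w → value (assign X w) x ≡ just (lookup w x)
value-assign⁺ here                         (b ∷ w) = refl
value-assign⁺ {X = inside  ∷ X} (there x∈X) (b ∷ w) = value-assign⁺ x∈X w
value-assign⁺ {X = outside ∷ X} (there x∈X) (b ∷ w) = value-assign⁺ x∈X w

value-assign⁻ : ∀ (X : Subset n) x w {b} → value (assign X w) x ≡ just b → lookup w x ≡ b
value-assign⁻ (inside  ∷ X) zero    (b ∷ w) refl = refl
value-assign⁻ (outside ∷ X) zero    (b ∷ w) ()
value-assign⁻ (inside  ∷ X) (suc x) (b ∷ w) eq   = value-assign⁻ X x w eq
value-assign⁻ (outside ∷ X) (suc x) (b ∷ w) eq   = value-assign⁻ X x w eq

assign∈assignments : ∀ (X : Subset n) w → assign X w ∈ₗ assignments X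
assign∈assignments []            []          = here refl
assign∈assignments (outside ∷ X) (b ∷ w)     = ∈-map⁺ skip (assign∈assignments X w)
assign∈assignments (inside  ∷ X) (false ∷ w) =
  ∈-++⁺ˡ (∈-map⁺ (false ∷_) (assign∈assignments X w))
assign∈assignments (inside  ∷ X) (true ∷ w)  =
  ∈-++⁺ʳ (map (false ∷_) (assignments X)) (∈-map⁺ (true ∷_) (assign∈assignments X w))

sum-map-++ : ∀ {A : Set} (g : A → ℕ) xs ys →
             sum (map g (xs ++ ys)) ≡ sum (map g xs) + sum (map g ys)
sum-map-++ g xs ys = trans (cong sum (List.map-++ g xs ys)) (sum-++ (map g xs) (map g ys))

-- The base valuation `w` is arbitrary: its bits in `X` are overwritten, and `assign X` does not
-- read the others.
sum-assignments : ∀ (X : Subset n) (c : Assignment X → ℕ) w →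
                  sum (map c (assignments X)) ≡ ∑ X (c ∘ assign X) w
sum-assignments []            c []      = ℕ.+-identityʳ _
sum-assignments (outside ∷ X) c (b ∷ w) = trans
  (cong sum (sym (List.map-∘ (assignments X)))) (sum-assignments X (c ∘ skip) w)
sum-assignments (inside  ∷ X) c (b ∷ w) = trans
  (sum-map-++ c (map (false ∷_) (assignments X)) (map (true ∷_) (assignments X)))
  (cong₂ _+_ (rec false) (rec true))
  where
  rec : ∀ b → sum (map c (map (b ∷_) (assignments X))) ≡ ∑ X (c ∘ (b ∷_) ∘ assign X) w
  rec b = trans (cong sum (sym (List.map-∘ (assignments X)))) (sum-assignments X (c ∘ (b ∷_)) w)

module _ {A B : Set} {q r} {Q : A → Set q} {R : B → Set r}
         (Q? : Decidable Q) (R? : Decidable R) where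

  -- Only the Boolean answers are compared, since the two predicates speak about assignments of
  -- different variable sets.
  filter-map : (f : B → A) → (∀ x → does (Q? (f x)) ≡ does (R? x)) →
               ∀ xs → filter Q? (map f xs) ≡ map f (filter R? xs)
  filter-map f Q≗R []       = refl
  filter-map f Q≗R (x ∷ xs) with does (Q? (f x)) | does (R? x) | Q≗R x
  ... | true  | true  | refl = cong (f x ∷_) (filter-map f Q≗R xs)
  ... | false | false | refl = filter-map f Q≗R xs

-- Marginalization as summation.

extensions : ∀ (X Z : Subset n) → Assignment (X ─ Z) → List (Assignment X)
extensions X Z S = filter (λ S′ → restrict (p─q⊆p X Z) S′ ≟ S) (assignments X)

-- An extension of the assignment induced on `X ─ Z` is fixed by `w` there and free on `Z`, so the
-- extensions correspond to the ways of overwriting `w` on `Z`. The induction goes through the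
-- variables one by one.
sum-extensions : ∀ (X Z : Subset n) → Z ⊆ X → (c : Assignment X → ℕ) → ∀ w →
  sum (map c (extensions X Z (assign (X ─ Z) w))) ≡ ∑ Z (c ∘ assign X) w
sum-extensions [] [] Z⊆X c [] = ℕ.+-identityʳ _
sum-extensions (outside ∷ X) (outside ∷ Z) Z⊆X c (b ∷ w) = begin
  sum (map c (extensions (outside ∷ X) (outside ∷ Z) (skip S)))
    ≡⟨ cong (sum ∘ map c) (filter-map _ _ skip (λ _ → refl) (assignments X)) ⟩
  sum (map c (map skip (extensions X Z S)))
    ≡⟨ cong sum (sym (List.map-∘ (extensions X Z S))) ⟩
  sum (map (c ∘ skip) (extensions X Z S))
    ≡⟨ sum-extensions X Z (drop-∷-⊆ Z⊆X) (c ∘ skip) w ⟩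
  ∑ Z (c ∘ skip ∘ assign X) w ∎
  where S = assign (X ─ Z) w
sum-extensions (outside ∷ X) (inside ∷ Z) Z⊆X c (b ∷ w) with () ← Z⊆X here
-- The first variable is summed out: both of its values occur among the extensions, which gives the
-- two halves of the sum.
sum-extensions (inside ∷ X) (inside ∷ Z) Z⊆X c (b ∷ w) = begin
  sum (map c (extensions (inside ∷ X) (inside ∷ Z) (skip S)))
    ≡⟨ cong (sum ∘ map c) (List.filter-++ _ (map (false ∷_) (assignments X)) _) ⟩
  sum (map c (half false ++ half true))
    ≡⟨ sum-map-++ c (half false) (half true) ⟩
  sum (map c (half false)) + sum (map c (half true))
    ≡⟨ cong₂ _+_ (rec false) (rec true) ⟩
  ∑ Z (c ∘ (false ∷_) ∘ assign X) w + ∑ Z (c ∘ (true ∷_) ∘ assign X) w ∎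
  where
  S = assign (X ─ Z) w
  half : Bool → List (Assignment (inside ∷ X))
  half b = filter (λ S′ → restrict (p─q⊆p (inside ∷ X) (inside ∷ Z)) S′ ≟ skip S)
             (map (b ∷_) (assignments X))
  rec : ∀ b → sum (map c (half b)) ≡ ∑ Z (c ∘ (b ∷_) ∘ assign X) w
  rec b = begin
    sum (map c (half b))
      ≡⟨ cong (sum ∘ map c) (filter-map _ _ (b ∷_) (λ _ → refl) (assignments X)) ⟩
    sum (map c (map (b ∷_) (extensions X Z S)))
      ≡⟨ cong sum (sym (List.map-∘ (extensions X Z S))) ⟩
    sum (map (c ∘ (b ∷_)) (extensions X Z S))
      ≡⟨ sum-extensions X Z (drop-∷-⊆ Z⊆X) (c ∘ (b ∷_)) w ⟩
    ∑ Z (c ∘ (b ∷_) ∘ assign X) w ∎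
-- The first variable is kept: only assignments with its value `b` can extend `b ∷ S`, so one half
-- of the list is filtered away entirely.
sum-extensions (inside ∷ X) (outside ∷ Z) Z⊆X c (b ∷ w) = begin
  sum (map c (extensions (inside ∷ X) (outside ∷ Z) (b ∷ S)))
    ≡⟨ cong (sum ∘ map c) (extensions-∷ b) ⟩
  sum (map c (map (b ∷_) (extensions X Z S)))
    ≡⟨ cong sum (sym (List.map-∘ (extensions X Z S))) ⟩
  sum (map (c ∘ (b ∷_)) (extensions X Z S))
    ≡⟨ sum-extensions X Z (drop-∷-⊆ Z⊆X) (c ∘ (b ∷_)) w ⟩
  ∑ Z (c ∘ (b ∷_) ∘ assign X) w ∎
  where
  S = assign (X ─ Z) w
  half : Bool → Bool → List (Assignment (inside ∷ X))
  half b b′ = filter (λ S′ → restrict (p─q⊆p (inside ∷ X) (outside ∷ Z)) S′ ≟ b ∷ S)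
                (map (b′ ∷_) (assignments X))
  does-∷ : ∀ b {Y : Subset n} (S S′ : Assignment Y) →
           does (_≟_ {X = inside ∷ Y} (b ∷ S) (b ∷ S′)) ≡ does (S ≟ S′)
  does-∷ false S S′ with S ≟ S′
  ... | yes refl = refl
  ... | no  _    = refl
  does-∷ true  S S′ with S ≟ S′
  ... | yes refl = refl
  ... | no  _    = refl
  same : ∀ b → half b b ≡ map (b ∷_) (extensions X Z S)
  same b = filter-map _ _ (b ∷_) (λ S′ → does-∷ b _ S) (assignments X)
  ∷-injectiveˡ : ∀ {b b′ S S′} →
    _≡_ {A = Assignment (inside ∷ (X ─ Z))} (b ∷ S) (b′ ∷ S′) → b ≡ b′
  ∷-injectiveˡ refl = refl
  differ : ∀ b b′ → b′ ≢ b → half b b′ ≡ []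
  differ b b′ b′≢b = List.filter-none _ (All.map⁺ {f = b′ ∷_}
    (All.universal (λ _ → b′≢b ∘ ∷-injectiveˡ) (assignments X)))
  extensions-∷ : ∀ b → extensions (inside ∷ X) (outside ∷ Z) (b ∷ S) ≡ map (b ∷_) (extensions X Z S)
  extensions-∷ false = trans (List.filter-++ _ (map (false ∷_) (assignments X)) _)
    (trans (cong₂ _++_ (same false) (differ false true λ ())) (List.++-identityʳ _))
  extensions-∷ true  = trans (List.filter-++ _ (map (false ∷_) (assignments X)) _)
    (cong₂ _++_ (differ true false λ ()) (same true))

-- Tables as weights.

⟦_⟧ : Table n → Weight n
⟦ T ⟧ w = count T (assign (scope T) w)

⟦⟧-independent : ∀ {Z : Subset n} T → (∀ {x} → x ∈ scope T → x ∉ Z) → IndependentOf Z ⟦ T ⟧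
⟦⟧-independent T T∥Z w w′ w≈w′ = cong (count T) (assign-cong (scope T) (w≈w′ ∘ T∥Z))

⟦⊗⟧ : ∀ (T₁ T₂ : Table n) w → ⟦ T₁ ⊗ T₂ ⟧ w ≡ ⟦ T₁ ⟧ w * ⟦ T₂ ⟧ w
⟦⊗⟧ T₁ T₂ w = cong₂ _*_
  (cong (count T₁) (restrict-assign (scope T₁) (scope T₁ ∪ scope T₂) _ w))
  (cong (count T₂) (restrict-assign (scope T₂) (scope T₁ ∪ scope T₂) _ w))

⟦marginalize⟧ : ∀ Z (T : Table n) → Z ⊆ scope T → ⟦ marginalize Z T ⟧ ≗ ∑ Z ⟦ T ⟧
⟦marginalize⟧ Z T Z⊆T = sum-extensions (scope T) Z Z⊆T (count T)

agreeOn∩-assign : ∀ (X Y : Subset n) w → AgreeOn∩ (assign X w) (assign Y w)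
agreeOn∩-assign X Y w = trans (restrict-assign (X ∩ Y) X _ w) (sym (restrict-assign (X ∩ Y) Y _ w))

-- The matching entry of `T₂` is the assignment induced by the same `w`: it is an entry because its
-- count is nonzero.
⟦⋉⟧ : ∀ (T₁ T₂ : Table n) w → ⟦ T₂ ⟧ w ≢ 0 → ⟦ T₁ ⋉ T₂ ⟧ w ≡ ⟦ T₁ ⟧ w
⟦⋉⟧ T₁ T₂ w T₂≢0 = cong (if_then ⟦ T₁ ⟧ w else 0) (dec-true (matched? T₁ T₂ S₁) matched)
  where
  S₁ = assign (scope T₁) w
  S₂ = assign (scope T₂) w
  S₂∈entries : S₂ ∈ₗ entries T₂
  S₂∈entries = ∈-filter⁺ (λ S → ¬? (count T₂ S ℕ.≟ 0)) (assign∈assignments (scope T₂) w) T₂≢0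
  matched : Matched T₁ T₂ S₁
  matched = Any.map (λ { refl → agreeOn∩-assign (scope T₁) (scope T₂) w }) S₂∈entries

⟦⋉⟧-zero : ∀ (T₁ T₂ : Table n) w → ⟦ T₁ ⟧ w ≡ 0 → ⟦ T₁ ⋉ T₂ ⟧ w ≡ 0
⟦⋉⟧-zero T₁ T₂ w T₁≡0 with does (matched? T₁ T₂ (assign (scope T₁) w))
... | true  = T₁≡0
... | false = refl

-- If a factor is zero at `w`, filtering keeps it zero and both products vanish. If neither is, each
-- induced assignment is matched by the other one and nothing is deleted.
⟦⋉⟧-* : ∀ (T₁ T₂ : Table n) w → ⟦ T₁ ⋉ T₂ ⟧ w * ⟦ T₂ ⋉ T₁ ⟧ w ≡ ⟦ T₁ ⟧ w * ⟦ T₂ ⟧ w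
⟦⋉⟧-* T₁ T₂ w with ⟦ T₁ ⟧ w ℕ.≟ 0 | ⟦ T₂ ⟧ w ℕ.≟ 0
... | yes T₁≡0 | _ = begin
  ⟦ T₁ ⋉ T₂ ⟧ w * ⟦ T₂ ⋉ T₁ ⟧ w  ≡⟨ cong (_* ⟦ T₂ ⋉ T₁ ⟧ w) (⟦⋉⟧-zero T₁ T₂ w T₁≡0) ⟩
  0                              ≡⟨ cong (_* ⟦ T₂ ⟧ w) (sym T₁≡0) ⟩
  ⟦ T₁ ⟧ w * ⟦ T₂ ⟧ w            ∎
... | no _ | yes T₂≡0 = begin
  ⟦ T₁ ⋉ T₂ ⟧ w * ⟦ T₂ ⋉ T₁ ⟧ w  ≡⟨ cong (⟦ T₁ ⋉ T₂ ⟧ w *_) (⟦⋉⟧-zero T₂ T₁ w T₂≡0) ⟩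
  ⟦ T₁ ⋉ T₂ ⟧ w * 0              ≡⟨ ℕ.*-zeroʳ (⟦ T₁ ⋉ T₂ ⟧ w) ⟩
  0                              ≡⟨ sym (ℕ.*-zeroʳ (⟦ T₁ ⟧ w)) ⟩
  ⟦ T₁ ⟧ w * 0                   ≡⟨ cong (⟦ T₁ ⟧ w *_) (sym T₂≡0) ⟩
  ⟦ T₁ ⟧ w * ⟦ T₂ ⟧ w            ∎
... | no T₁≢0 | no T₂≢0 = cong₂ _*_ (⟦⋉⟧ T₁ T₂ w T₂≢0) (⟦⋉⟧ T₂ T₁ w T₁≢0)

sum-filter-nonzero : ∀ {A : Set} (g : A → ℕ) xs →
                     sum (map g (filter (λ x → ¬? (g x ℕ.≟ 0)) xs)) ≡ sum (map g xs)
sum-filter-nonzero g []       = refl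
sum-filter-nonzero g (x ∷ xs) with g x in gx≡
... | zero  = sum-filter-nonzero g xs
... | suc m rewrite gx≡ = cong (suc m +_) (sum-filter-nonzero g xs)

sum-entries : ∀ (T : Table n) w → sum (map (count T) (entries T)) ≡ ∑ (scope T) ⟦ T ⟧ w
sum-entries T w = trans (sum-filter-nonzero (count T) (assignments (scope T)))
                        (sum-assignments (scope T) (count T) w)

-- The total of a family of tables.

Tables : ℕ → ℕ → Set
Tables n P = Vector (Table n) P

weight : Subset P → Tables n P → Weight n
weight R ts w = ∏ R (λ i → ⟦ ts i ⟧ w)

weight-independent : ∀ (R : Subset P) (ts : Tables n P) {Z} →
  (∀ {i x} → i ∈ R → x ∈ scope (ts i) → x ∉ Z) → IndependentOf Z (weight R ts)
weight-independent R ts ts∥Z w w′ w≈w′ =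
  ∏-cong R λ {i} i∈R → ⟦⟧-independent (ts i) (ts∥Z i∈R) w w′ w≈w′

weight-updateAt : ∀ {R : Subset P} {i} (ts : Tables n P) h w →
  (∀ {k} → k ∈ R → k ≢ i) → weight R (updateAt ts i h) w ≡ weight R ts w
weight-updateAt {R = R} {i} ts h w R∌i =
  ∏-cong R λ {k} k∈R → cong (λ T → ⟦ T ⟧ w) (updateAt-minimal k i ts (R∌i k∈R))

-- The union is characterized by its members instead of being computed, so an operation only has to
-- account for where each variable can be found before and after it.
record IsScopeUnion (R : Subset P) (ts : Tables n P) (U : Subset n) : Set where
  field
    locate : ∀ {x} → x ∈ U → ∃[ i ] i ∈ R × x ∈ scope (ts i)
    cover  : ∀ {x i} → i ∈ R → x ∈ scope (ts i) → x ∈ U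

open IsScopeUnion

HasTotal : Subset P → Tables n P → ℕ → Set
HasTotal R ts N = ∀ {U} → IsScopeUnion R ts U → ∀ w → ∑ U (weight R ts) w ≡ N

Shared : Tables n P → Fin P → Fin P → Set
Shared ts a b = ∃[ x ] x ∈ scope (ts a) × x ∈ scope (ts b)

module _ (ts : Tables n P) (i : Fin P) (Z : Subset n) where

  private ts′ = updateAt ts i (marginalize Z)

  scope-marginalize⁻ : ∀ k {x} → x ∈ scope (ts′ k) → x ∈ scope (ts k)
  scope-marginalize⁻ k x∈ with k Fin.≟ i
  ... | yes refl rewrite updateAt-updates i {marginalize Z} ts = p─q⊆p (scope (ts i)) Z x∈
  ... | no  k≢i  rewrite updateAt-minimal k i {marginalize Z} ts k≢i = x∈

  scope-marginalize⁺ : ∀ k {x} → x ∈ scope (ts k) → (k ≡ i → x ∉ Z) → x ∈ scope (ts′ k)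
  scope-marginalize⁺ k x∈ x∉Z with k Fin.≟ i
  ... | yes refl rewrite updateAt-updates i {marginalize Z} ts = x∈p∧x∉q⇒x∈p─q x∈ (x∉Z refl)
  ... | no  k≢i  rewrite updateAt-minimal k i {marginalize Z} ts k≢i = x∈

  scope-marginalize-∉ : ∀ {x} → x ∈ scope (ts′ i) → x ∉ Z
  scope-marginalize-∉ x∈ rewrite updateAt-updates i {marginalize Z} ts = x∈p─q⇒x∉q (scope (ts i)) Z x∈

-- The invariant under Marginalize, Reduce and Merge.

-- The edges are tracked together with the total because message passing has to turn a shared
-- variable into an edge, which is `adjacent⁺`.
record Invariant (N : ℕ) (G : Graph n P) : Set where
  field
    adjacent⁻ : ∀ {a b} → Adjacent G a b →
                a ∈ vertices G × b ∈ vertices G × a ≢ b × Shared (tables G) a b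
    adjacent⁺ : ∀ {a b} → a ∈ vertices G → b ∈ vertices G → a ≢ b →
                Shared (tables G) a b → Adjacent G a b
    total     : HasTotal (vertices G) (tables G) N

open Invariant

module _ {N : ℕ} {G : Graph n P} (inv : Invariant N G) where

  private
    V  = vertices G
    ts = tables G

  -- As `x` lies in the scope of `i` alone, no edge rests on it, and the product of the other tables
  -- is independent of it. Hence the sum over `x` moves inside to the table of `i`.
  marginalizeAt-invariant : ∀ {i x} → i ∈ V → x ∈ scope (ts i) →
    (∀ {j} → j ∈ V → x ∈ scope (ts j) → j ≡ i) → Invariant N (marginalizeAt i x G)
  marginalizeAt-invariant {i} {x} i∈V x∈i only-i = record
    { adjacent⁻ = λ ab → let (a∈V , b∈V , a≢b , y , y∈a , y∈b) = adjacent⁻ inv ab in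
        a∈V , b∈V , a≢b , y ,
        scope-marginalize⁺ ts i ⁅ x ⁆ _ y∈a (λ { refl → fresh b∈V y∈b (a≢b ∘ sym) }) ,
        scope-marginalize⁺ ts i ⁅ x ⁆ _ y∈b (λ { refl → fresh a∈V y∈a a≢b })
    ; adjacent⁺ = λ {a} {b} a∈V b∈V a≢b (y , y∈a , y∈b) → adjacent⁺ inv a∈V b∈V a≢b
        (y , scope-marginalize⁻ ts i ⁅ x ⁆ a y∈a , scope-marginalize⁻ ts i ⁅ x ⁆ b y∈b)
    ; total = total′
    }
    where
    ts′ = updateAt ts i (marginalize ⁅ x ⁆)

    fresh : ∀ {b y} → b ∈ V → y ∈ scope (ts b) → b ≢ i → y ∉ ⁅ x ⁆
    fresh b∈V y∈b b≢i y∈⁅x⁆ with refl ← x∈⁅y⁆⇒x≡y x y∈⁅x⁆ = b≢i (only-i b∈V y∈b)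

    ⁅x⁆⊆i : ⁅ x ⁆ ⊆ scope (ts i)
    ⁅x⁆⊆i y∈⁅x⁆ with refl ← x∈⁅y⁆⇒x≡y x y∈⁅x⁆ = x∈i

    rest-independent : IndependentOf ⁅ x ⁆ (weight (V - i) ts)
    rest-independent = weight-independent (V - i) ts
      λ {k} k∈ y∈k → fresh (p─q⊆p V ⁅ i ⁆ k∈) y∈k (x∈p-y⇒x≢y V k∈)

    total′ : HasTotal V ts′ N
    total′ {U} union w = begin
      ∑ U (weight V ts′) w
        ≡⟨ ∑-cong U (λ w → trans (∏-extract i∈V _) (cong₂ _*_
             (weight-updateAt ts _ w (x∈p-y⇒x≢y V))
             (trans (cong (λ T → ⟦ T ⟧ w) (updateAt-updates i ts))
                    (⟦marginalize⟧ ⁅ x ⁆ (ts i) ⁅x⁆⊆i w)))) w ⟩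
      ∑ U (λ w → weight (V - i) ts w * ∑ ⁅ x ⁆ ⟦ ts i ⟧ w) w
        ≡⟨ sym (∑-eliminate U ⁅ x ⁆ disjoint rest-independent ⟦ ts i ⟧ w) ⟩
      ∑ (U ∪ ⁅ x ⁆) (λ w → weight (V - i) ts w * ⟦ ts i ⟧ w) w
        ≡⟨ ∑-cong (U ∪ ⁅ x ⁆) (λ w → sym (∏-extract i∈V _)) w ⟩
      ∑ (U ∪ ⁅ x ⁆) (weight V ts) w
        ≡⟨ total inv union′ w ⟩
      N ∎
      where
      disjoint : ∀ {y} → y ∈ U → y ∉ ⁅ x ⁆
      disjoint y∈U with k , k∈V , y∈k ← locate union y∈U with k Fin.≟ i
      ... | yes refl = scope-marginalize-∉ ts i ⁅ x ⁆ y∈k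
      ... | no  k≢i  = fresh k∈V (scope-marginalize⁻ ts i ⁅ x ⁆ k y∈k) k≢i

      -- Before the operation the scopes cover exactly one more variable, the eliminated `x`.
      union′ : IsScopeUnion V ts (U ∪ ⁅ x ⁆)
      union′ .locate y∈ with x∈p∪q⁻ U ⁅ x ⁆ y∈
      ... | inj₁ y∈U = let (k , k∈V , y∈k) = locate union y∈U in
                       k , k∈V , scope-marginalize⁻ ts i ⁅ x ⁆ k y∈k
      ... | inj₂ y∈⁅x⁆ = i , i∈V , ⁅x⁆⊆i y∈⁅x⁆
      union′ .cover {y} {k} k∈V y∈k with y ∈? ⁅ x ⁆
      ... | yes y∈⁅x⁆ = q⊆p∪q U ⁅ x ⁆ y∈⁅x⁆
      ... | no  y∉⁅x⁆ = p⊆p∪q ⁅ x ⁆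
        (cover union k∈V (scope-marginalize⁺ ts i ⁅ x ⁆ k y∈k (λ _ → y∉⁅x⁆)))

  -- Scopes do not change, so the edges and the union stay; in the product only the two factors at
  -- `i` and `j` change, and `⟦⋉⟧-*` shows that they have the same product as before.
  deleteUnmatched-invariant : ∀ {i j} → Adjacent G i j → Invariant N (deleteUnmatched i j G)
  deleteUnmatched-invariant {i} {j} ij = record
    { adjacent⁻ = λ ab → let (a∈V , b∈V , a≢b , x , x∈a , x∈b) = adjacent⁻ inv ab in
        a∈V , b∈V , a≢b , x , subst (x ∈_) (sym (same _)) x∈a , subst (x ∈_) (sym (same _)) x∈b
    ; adjacent⁺ = λ a∈V b∈V a≢b (x , x∈a , x∈b) → adjacent⁺ inv a∈V b∈V a≢b
        (x , subst (x ∈_) (same _) x∈a , subst (x ∈_) (same _) x∈b)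
    ; total = λ {U} union w → trans (∑-cong U same-weight w) (total inv (record
        { locate = λ {x} x∈U → let (k , k∈V , x∈k) = locate union x∈U in
                   k , k∈V , subst (x ∈_) (same k) x∈k
        ; cover  = λ {x} {k} k∈V x∈k → cover union k∈V (subst (x ∈_) (sym (same k)) x∈k)
        }) w)
    }
    where
    i∈V = proj₁ (adjacent⁻ inv ij)
    j∈V = proj₁ (proj₂ (adjacent⁻ inv ij))
    i≢j = proj₁ (proj₂ (proj₂ (adjacent⁻ inv ij)))

    tsᵢ = updateAt ts i (_⋉ ts j)
    ts′ = updateAt tsᵢ j (_⋉ ts i)

    -- Since `i` and `j` differ, neither update disturbs the table of the other vertex.
    at-i : ts′ i ≡ ts i ⋉ ts j
    at-i = trans (updateAt-minimal i j tsᵢ i≢j) (updateAt-updates i ts)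

    at-j : ts′ j ≡ ts j ⋉ ts i
    at-j = trans (updateAt-updates j tsᵢ) (cong (_⋉ ts i) (updateAt-minimal j i ts (i≢j ∘ sym)))

    at-other : ∀ k → k ≢ i → k ≢ j → ts′ k ≡ ts k
    at-other k k≢i k≢j = trans (updateAt-minimal k j tsᵢ k≢j) (updateAt-minimal k i ts k≢i)

    same : ∀ k → scope (ts′ k) ≡ scope (ts k)
    same k with k Fin.≟ i | k Fin.≟ j
    ... | yes refl | _        = cong scope at-i
    ... | no _     | yes refl = cong scope at-j
    ... | no k≢i   | no k≢j   = cong scope (at-other k k≢i k≢j)

    same-weight : ∀ w → weight V ts′ w ≡ weight V ts w
    same-weight w = begin
      weight V ts′ w
        ≡⟨ ∏-extract₂ i∈V j∈V (i≢j ∘ sym) _ ⟩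
      weight (V - i - j) ts′ w * (⟦ ts′ i ⟧ w * ⟦ ts′ j ⟧ w)
        ≡⟨ cong₂ _*_
             (∏-cong (V - i - j) λ {k} k∈ → cong (λ T → ⟦ T ⟧ w)
               (at-other k (x∈p-y⇒x≢y V (p─q⊆p (V - i) ⁅ j ⁆ k∈)) (x∈p-y⇒x≢y (V - i) k∈)))
             (trans (cong₂ (λ T T′ → ⟦ T ⟧ w * ⟦ T′ ⟧ w) at-i at-j) (⟦⋉⟧-* (ts i) (ts j) w)) ⟩
      weight (V - i - j) ts w * (⟦ ts i ⟧ w * ⟦ ts j ⟧ w)
        ≡⟨ sym (∏-extract₂ i∈V j∈V (i≢j ∘ sym) _) ⟩
      weight V ts w ∎

  -- The factor of the removed vertex `j` moves into that of `i`, and the variables of `j` are now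
  -- found at `i`. So neither the product nor the union of the scopes changes.
  mergeVertices-invariant : ∀ {i j} → Adjacent G i j → Invariant N (mergeVertices i j G)
  mergeVertices-invariant {i} {j} ij = record
    { adjacent⁻ = adj⁻
    ; adjacent⁺ = λ a∈ b∈ a≢b shared → a≢b , x∈p-y⇒x≢y V a∈ , x∈p-y⇒x≢y V b∈ ,
                                       adj⁺ a∈ b∈ a≢b shared
    ; total = λ {U} union w → trans (∑-cong U same-weight w) (total inv (union′ union) w)
    }
    where
    i∈V = proj₁ (adjacent⁻ inv ij)
    j∈V = proj₁ (proj₂ (adjacent⁻ inv ij))
    i≢j = proj₁ (proj₂ (proj₂ (adjacent⁻ inv ij)))
    i∈V-j : i ∈ V - j
    i∈V-j = x∈p∧x≢y⇒x∈p-y i∈V i≢j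

    ts′ = updateAt ts i (_⊗ ts j)

    grow : ∀ k {x} → x ∈ scope (ts k) → x ∈ scope (ts′ k)
    grow k x∈k with k Fin.≟ i
    ... | yes refl rewrite updateAt-updates i {_⊗ ts j} ts = p⊆p∪q (scope (ts j)) x∈k
    ... | no  k≢i  rewrite updateAt-minimal k i {_⊗ ts j} ts k≢i = x∈k

    absorb : ∀ {x} → x ∈ scope (ts j) → x ∈ scope (ts′ i)
    absorb x∈j rewrite updateAt-updates i {_⊗ ts j} ts = q⊆p∪q (scope (ts i)) (scope (ts j)) x∈j

    -- Applied to both ends of a shared variable, this distinguishes an old edge from one that `i`
    -- inherits from `j`.
    origin : ∀ k {x} → x ∈ scope (ts′ k) → x ∈ scope (ts k) ⊎ (k ≡ i × x ∈ scope (ts j))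
    origin k x∈k with k Fin.≟ i
    ... | no  k≢i  rewrite updateAt-minimal k i {_⊗ ts j} ts k≢i = inj₁ x∈k
    ... | yes refl rewrite updateAt-updates i {_⊗ ts j} ts
      with x∈p∪q⁻ (scope (ts i)) (scope (ts j)) x∈k
    ...   | inj₁ x∈i = inj₁ x∈i
    ...   | inj₂ x∈j = inj₂ (refl , x∈j)

    adj⁻ : ∀ {a b} → Adjacent (mergeVertices i j G) a b →
           a ∈ V - j × b ∈ V - j × a ≢ b × Shared ts′ a b
    adj⁻ (a≢b , a≢j , b≢j , inj₁ ab) with adjacent⁻ inv ab
    ... | a∈V , b∈V , _ , x , x∈a , x∈b =
      x∈p∧x≢y⇒x∈p-y a∈V a≢j , x∈p∧x≢y⇒x∈p-y b∈V b≢j , a≢b , x , grow _ x∈a , grow _ x∈b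
    adj⁻ (a≢b , a≢j , b≢j , inj₂ (inj₁ (refl , jb))) with adjacent⁻ inv jb
    ... | _ , b∈V , _ , x , x∈j , x∈b =
      i∈V-j , x∈p∧x≢y⇒x∈p-y b∈V b≢j , a≢b , x , absorb x∈j , grow _ x∈b
    adj⁻ (a≢b , a≢j , b≢j , inj₂ (inj₂ (refl , aj))) with adjacent⁻ inv aj
    ... | a∈V , _ , _ , x , x∈a , x∈j =
      x∈p∧x≢y⇒x∈p-y a∈V a≢j , i∈V-j , a≢b , x , grow _ x∈a , absorb x∈j

    adj⁺ : ∀ {a b} → a ∈ V - j → b ∈ V - j → a ≢ b → Shared ts′ a b →
           Adjacent G a b ⊎ (a ≡ i × Adjacent G j b) ⊎ (b ≡ i × Adjacent G a j)
    adj⁺ {a} {b} a∈ b∈ a≢b (x , x∈a , x∈b) with origin a x∈a | origin b x∈b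
    ... | inj₁ x∈a | inj₁ x∈b =
      inj₁ (adjacent⁺ inv (p─q⊆p V ⁅ j ⁆ a∈) (p─q⊆p V ⁅ j ⁆ b∈) a≢b (x , x∈a , x∈b))
    ... | inj₂ (a≡i , x∈j) | inj₁ x∈b = inj₂ (inj₁ (a≡i ,
      adjacent⁺ inv j∈V (p─q⊆p V ⁅ j ⁆ b∈) (x∈p-y⇒x≢y V b∈ ∘ sym) (x , x∈j , x∈b)))
    ... | inj₁ x∈a | inj₂ (b≡i , x∈j) = inj₂ (inj₂ (b≡i ,
      adjacent⁺ inv (p─q⊆p V ⁅ j ⁆ a∈) j∈V (x∈p-y⇒x≢y V a∈) (x , x∈a , x∈j)))
    ... | inj₂ (a≡i , _) | inj₂ (b≡i , _) = contradiction (trans a≡i (sym b≡i)) a≢b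

    union′ : ∀ {U} → IsScopeUnion (V - j) ts′ U → IsScopeUnion V ts U
    union′ union .locate x∈U with k , k∈ , x∈k ← locate union x∈U with origin k x∈k
    ... | inj₁ x∈k       = k , p─q⊆p V ⁅ j ⁆ k∈ , x∈k
    ... | inj₂ (_ , x∈j) = j , j∈V , x∈j
    union′ union .cover {x} {k} k∈V x∈k with k Fin.≟ j
    ... | yes refl = cover union i∈V-j (absorb x∈k)
    ... | no  k≢j  = cover union (x∈p∧x≢y⇒x∈p-y k∈V k≢j) (grow k x∈k)

    same-weight : ∀ w → weight (V - j) ts′ w ≡ weight V ts w
    same-weight w = begin
      weight (V - j) ts′ w
        ≡⟨ ∏-extract i∈V-j _ ⟩
      weight (V - j - i) ts′ w * ⟦ ts′ i ⟧ w
        ≡⟨ cong₂ _*_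
             (weight-updateAt ts _ w (x∈p-y⇒x≢y (V - j)))
             (trans (cong (λ T → ⟦ T ⟧ w) (updateAt-updates i ts)) (⟦⊗⟧ (ts i) (ts j) w)) ⟩
      weight (V - j - i) ts w * (⟦ ts i ⟧ w * ⟦ ts j ⟧ w)
        ≡⟨ cong (weight (V - j - i) ts w *_) (ℕ.*-comm (⟦ ts i ⟧ w) _) ⟩
      weight (V - j - i) ts w * (⟦ ts j ⟧ w * ⟦ ts i ⟧ w)
        ≡⟨ sym (∏-extract₂ j∈V i∈V i≢j _) ⟩
      weight V ts w ∎

reduces-invariant : ∀ {N} {G G′ : Graph n P} → Reduces G G′ → Invariant N G → Invariant N G′
reduces-invariant (stop _)         inv = inv
reduces-invariant (step _ ij rest) inv =
  reduces-invariant rest (deleteUnmatched-invariant inv ij)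

operations-invariant : ∀ {N E} {G G′ : Graph n P} →
  Operations E G G′ → Invariant N G → Invariant N G′
operations-invariant ε inv = inv
operations-invariant (marginalizeOp _ i∈V x∈i only-i ◅ ops) inv =
  operations-invariant ops (marginalizeAt-invariant inv i∈V x∈i only-i)
operations-invariant (reduceOp red ◅ ops) inv =
  operations-invariant ops (reduces-invariant red inv)
operations-invariant (mergeOp ij ◅ ops) inv =
  operations-invariant ops (mergeVertices-invariant inv ij)

-- Satisfaction and the initial graph.

∈⋃⁺ : ∀ {Xs : List (Subset n)} {X x} → X ∈ₗ Xs → x ∈ X → x ∈ ⋃ Xs
∈⋃⁺ {Xs = X ∷ Xs} (here refl) x∈X = p⊆p∪q (⋃ Xs) x∈X
∈⋃⁺ {Xs = Y ∷ Xs} (there X∈)  x∈X = q⊆p∪q Y (⋃ Xs) (∈⋃⁺ X∈ x∈X)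

∈⋃⁻ : ∀ (Xs : List (Subset n)) {x} → x ∈ ⋃ Xs → ∃[ X ] X ∈ₗ Xs × x ∈ X
∈⋃⁻ []       x∈ = contradiction x∈ ∉⊥
∈⋃⁻ (X ∷ Xs) x∈ with x∈p∪q⁻ X (⋃ Xs) x∈
... | inj₁ x∈X  = X , here refl , x∈X
... | inj₂ x∈Xs = let (Y , Y∈Xs , x∈Y) = ∈⋃⁻ Xs x∈Xs in Y , there Y∈Xs , x∈Y

∈vars⁺ : ∀ {F : CNF n} {c l} → c ∈ₗ F → l ∈ₗ c → proj₁ l ∈ vars F
∈vars⁺ {l = x , _} c∈F l∈c = ∈⋃⁺ (∈-map⁺ (⁅_⁆ ∘ proj₁) (∈-concat⁺′ l∈c c∈F)) (x∈⁅x⁆ x)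

∈vars⁻ : ∀ (F : CNF n) {x} → x ∈ vars F → ∃[ c ] c ∈ₗ F × ∃[ b ] (x , b) ∈ₗ c
∈vars⁻ F x∈F with X , X∈ , x∈X ← ∈⋃⁻ _ x∈F
  with (y , b) , l∈ , refl ← ∈-map⁻ (⁅_⁆ ∘ proj₁) X∈
  with refl ← x∈⁅y⁆⇒x≡y y x∈X
  with c , l∈c , c∈F ← ∈-concat⁻′ F l∈ = c , c∈F , b , l∈c

-- Phrased for total valuations, so that a formula and its parts can be compared although their
-- variable sets differ.
SatisfiedBy : CNF n → Vec Bool n → Set
SatisfiedBy F w = All (Any (λ (x , b) → lookup w x ≡ b)) F

satisfies⇒satisfiedBy : ∀ X (F : CNF n) w → Satisfies F (assign X w) → SatisfiedBy F w
satisfies⇒satisfiedBy X F w = All.map (Any.map (λ {(x , _)} → value-assign⁻ X x w))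

satisfiedBy⇒satisfies : ∀ (F : CNF n) w → SatisfiedBy F w → Satisfies F (assign (vars F) w)
satisfiedBy⇒satisfies F w sat = All.tabulate λ c∈F →
  let ((x , b) , l∈c , wx≡b) = find (All.lookup sat c∈F) in
  lose l∈c (trans (value-assign⁺ (∈vars⁺ c∈F l∈c) w) (cong just wx≡b))

initial-one : ∀ (F : CNF n) w → SatisfiedBy F w → ⟦ initialTable F ⟧ w ≡ 1
initial-one F w sat = cong (if_then 1 else 0)
  (dec-true (satisfies? F (assign (vars F) w)) (satisfiedBy⇒satisfies F w sat))

initial-zero : ∀ (F : CNF n) w → ¬ SatisfiedBy F w → ⟦ initialTable F ⟧ w ≡ 0
initial-zero F w ¬sat = cong (if_then 1 else 0)
  (dec-false (satisfies? F (assign (vars F) w)) (¬sat ∘ satisfies⇒satisfiedBy (vars F) F w))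

satisfiedBy? : (F : CNF n) → Decidable (SatisfiedBy F)
satisfiedBy? F w = All.all? (Any.any? λ (x , b) → lookup w x Bool.≟ b) F

length-filter : ∀ {A : Set} {p} {Q : A → Set p} (Q? : Decidable Q) xs →
                length (filter Q? xs) ≡ sum (map (λ x → if does (Q? x) then 1 else 0) xs)
length-filter Q? []       = refl
length-filter Q? (x ∷ xs) with does (Q? x)
... | true  = cong suc (length-filter Q? xs)
... | false = length-filter Q? xs

-- Here `initialTable` is taken for the whole formula and serves as the indicator of its satisfying
-- assignments.
satCount-∑ : ∀ (F : CNF n) w → satCount F ≡ ∑ (vars F) ⟦ initialTable F ⟧ w
satCount-∑ F w = trans (length-filter (satisfies? F) (assignments (vars F)))
                       (sum-assignments (vars F) (count (initialTable F)) w)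

module _ {F : CNF n} {parts : Vector (CNF n) P} (partition : PartitionedInto F parts) where

  private
    satisfiedBy-parts : ∀ w → SatisfiedBy F w → ∀ i → SatisfiedBy (parts i) w
    satisfiedBy-parts w sat =
      All.tabulate⁻ (All.concat⁻ (All-resp-↭ (↭-sym partition) sat))

    satisfiedBy-whole : ∀ w → (∀ i → SatisfiedBy (parts i) w) → SatisfiedBy F w
    satisfiedBy-whole w sats = All-resp-↭ partition (All.concat⁺ (All.tabulate⁺ sats))

    -- The indicator of a conjunction is the product of the indicators of its parts.
    weight-initial : ∀ w → weight ⊤ (initialTable ∘ parts) w ≡ ⟦ initialTable F ⟧ w
    weight-initial w with satisfiedBy? F w
    ... | yes sat = trans
      (∏-one ⊤ λ {i} _ → initial-one (parts i) w (satisfiedBy-parts w sat i))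
      (sym (initial-one F w sat))
    -- There are finitely many parts and satisfaction is decidable, so a violated part can be found;
    -- its factor is zero.
    ... | no ¬sat
      with i , ¬satᵢ ← Fin.¬∀⟶∃¬ _ _ (λ i → satisfiedBy? (parts i) w) (¬sat ∘ satisfiedBy-whole w) =
      trans (∏-zero {f = λ i → ⟦ initialTable (parts i) ⟧ w} (∈⊤ {x = i})
               (initial-zero (parts i) w ¬satᵢ))
            (sym (initial-zero F w ¬sat))

    vars-union : ∀ {U} → IsScopeUnion ⊤ (initialTable ∘ parts) U → U ≡ vars F
    vars-union {U} union = ⊆-antisym U⊆F F⊆U
      where
      U⊆F : U ⊆ vars F
      U⊆F x∈U with i , _ , x∈i ← locate union x∈U
        with c , c∈i , b , l∈c ← ∈vars⁻ (parts i) x∈i =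
        ∈vars⁺ (Any-resp-↭ partition (∈-concat⁺′ c∈i (∈-tabulate⁺ i))) l∈c

      F⊆U : vars F ⊆ U
      F⊆U x∈F with c , c∈F , b , l∈c ← ∈vars⁻ F x∈F
        with Fᵢ , c∈Fᵢ , Fᵢ∈ ← ∈-concat⁻′ (tabulate parts) (Any-resp-↭ (↭-sym partition) c∈F)
        with i , refl ← ∈-tabulate⁻ Fᵢ∈ = cover union (∈⊤ {x = i}) (∈vars⁺ c∈Fᵢ l∈c)

  initial-invariant : Invariant (satCount F) (initial parts)
  initial-invariant = record
    { adjacent⁻ = λ (a≢b , x , x∈) → ∈⊤ , ∈⊤ , a≢b , x , x∈p∩q⁻ _ _ x∈
    ; adjacent⁺ = λ _ _ a≢b (x , x∈) → a≢b , x , x∈p∩q⁺ x∈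
    ; total     = total′
    }
    where
    total′ : HasTotal ⊤ (initialTable ∘ parts) (satCount F)
    total′ union w with refl ← vars-union union =
      trans (∑-cong (vars F) weight-initial w) (sym (satCount-∑ F w))

-- Prefixes of lists and simple paths.

module _ {A : Set} where

  -- The prefix that ends with the given occurrence of `x`. It cuts a path at a vertex from which an
  -- edge leads back to the start, so as to close a cycle.
  takeTo : ∀ {x : A} {xs} → x ∈ₗ xs → List A
  takeTo {x} (here _)             = x ∷ []
  takeTo {xs = y ∷ _} (there x∈) = y ∷ takeTo x∈

  takeTo-nonempty : ∀ {x : A} {xs} (x∈ : x ∈ₗ xs) → 1 ≤ length (takeTo x∈)
  takeTo-nonempty (here _)  = s≤s z≤n
  takeTo-nonempty (there _) = s≤s z≤n

  takeTo-All : ∀ {Q : A → Set} {x xs} (x∈ : x ∈ₗ xs) → All Q xs → All Q (takeTo x∈)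
  takeTo-All (here refl) (q ∷ _)  = q ∷ []
  takeTo-All (there x∈)  (q ∷ qs) = q ∷ takeTo-All x∈ qs

  takeTo-Unique : ∀ {x : A} {xs} (x∈ : x ∈ₗ xs) → Unique xs → Unique (takeTo x∈)
  takeTo-Unique (here _)   _        = [] ∷ []
  takeTo-Unique (there x∈) (y∉ ∷ u) = takeTo-All x∈ y∉ ∷ takeTo-Unique x∈ u

  takeTo-Linked : ∀ {R : A → A → Set} {x y z xs} (x∈ : x ∈ₗ xs) →
    Linked R (y ∷ xs) → R x z → Linked R (y ∷ takeTo x∈ ∷ʳ z)
  takeTo-Linked (here refl) (yx ∷ _) xz = yx ∷ xz ∷ [-]
  takeTo-Linked (there x∈)  (yx ∷ l) xz = yx ∷ takeTo-Linked x∈ l xz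

  last∈ : ∀ {x : A} xs → last xs ≡ just x → x ∈ₗ xs
  last∈ (x ∷ [])     refl = here refl
  last∈ (_ ∷ y ∷ xs) eq   = there (last∈ (y ∷ xs) eq)

SimplePath : (R : Fin P → Fin P → Set) → Fin P → List (Fin P) → Fin P → Set
SimplePath R v ws r = Linked R (v ∷ ws) × Unique (v ∷ ws) × last (v ∷ ws) ≡ just r

simplePath-suffix : ∀ {R : Fin P → Fin P → Set} {v r ws} u → u ∈ₗ v ∷ ws →
  SimplePath R v ws r → ∃[ ws′ ] SimplePath R u ws′ r
simplePath-suffix              u (here refl) path = _ , path
simplePath-suffix {ws = _ ∷ _} u (there u∈) (_ ∷ linked , _ ∷ unique , last≡) =
  simplePath-suffix u u∈ (linked , unique , last≡)

-- Loop erasure: when the new first vertex `v` already lies on the path found so far, the path is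
-- cut to begin there.
simplePath : ∀ {R : Fin P → Fin P → Set} {v r} → Star R v r → ∃[ ws ] SimplePath R v ws r
simplePath ε = [] , [-] , [] ∷ [] , refl
simplePath {v = v} (_◅_ {j = u} vu star)
  with ws , path@(linked , unique , last≡) ← simplePath star
  with Any.any? (v Fin.≟_) (u ∷ ws)
... | yes v∈ = simplePath-suffix v v∈ path
... | no  v∉ = u ∷ ws , vu ∷ linked , All.¬Any⇒All¬ (u ∷ ws) v∉ ∷ unique , last≡

-- Message passing on the rooted tree.

module _ {N : ℕ} {G : Graph n P} (inv : Invariant N G) (tree : IsTree G)
         (r : Fin P) (r∈V : r ∈ vertices G) where

  open IsTree tree

  private
    V  = vertices G
    ts = tables G

  parent⇒adjacent : ∀ {v u} → Parent G r v u → Adjacent G v u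
  parent⇒adjacent (_ , vu ∷ _ , _) = vu

  -- A path that starts at the root and has a further vertex would have to end at the root again, so
  -- it is not simple.
  root-has-no-parent : ∀ {u} → ¬ Parent G r r u
  root-has-no-parent {u} (ws , _ , r∉ ∷ _ , last≡) = All.lookup r∉ (last∈ (u ∷ ws) last≡) refl

  -- An edge from v to a later vertex of the path from v to r would close a cycle.
  neighbour-of-child : ∀ {v u w} → Parent G r v u → Adjacent G w v → w ≡ u ⊎ Parent G r w v
  neighbour-of-child {v} {u} {w} (ws , linked@(_ ∷ _) , unique@(v∉ ∷ unique′) , last≡) wv
    with Any.any? (w Fin.≟_) (u ∷ ws)
  ... | yes (here w≡u)   = inj₁ w≡u
  -- Here `w` lies beyond `u`, so the walk from `v` through `u` to `w` and back has at least two
  -- inner vertices, as a cycle requires.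
  ... | yes (there w∈ws) = contradiction
    ( s≤s (takeTo-nonempty w∈ws)
    , takeTo-All (there w∈ws) v∉ ∷ takeTo-Unique (there w∈ws) unique′
    , takeTo-Linked (there w∈ws) linked wv)
    (acyclic v (u ∷ takeTo w∈ws))
  -- Prepending `w` to the path of `v` gives a simple path to the root, which makes `v` the parent
  -- of `w`.
  ... | no  w∉ = inj₂ (u ∷ ws , wv ∷ linked ,
    (proj₁ (proj₂ (proj₂ (adjacent⁻ inv wv))) ∷ All.¬Any⇒All¬ (u ∷ ws) w∉) ∷ unique , last≡)

  -- A processed vertex has passed its factor on, so only the unprocessed ones enter the total. The
  -- field `scopes` ensures that the edges of `G` still describe which current tables share
  -- variables, and `closed` keeps parents of unprocessed vertices unprocessed.
  record MessageInvariant (σ : MessageState n P) : Set where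
    field
      scopes : ∀ k → scope (current σ k) ≡ scope (ts k)
      closed : ∀ {v w} → v ∈ processed σ → Parent G r w v → w ∈ processed σ
      root∉  : r ∉ processed σ
      remaining-total : HasTotal (V ─ processed σ) (current σ) N

  open MessageInvariant

  start-invariant : MessageInvariant (state ⊥ ts)
  start-invariant = record
    { scopes = λ _ → refl
    ; closed = λ v∈⊥ → contradiction v∈⊥ ∉⊥
    ; root∉  = ∉⊥
    ; remaining-total = subst (λ R → HasTotal R ts N) (sym (p─⊥≡p V)) (total inv)
    }

  -- Dropping `v` is variable elimination of `Z`: the sum over `Z` affects the factor of `v` only,
  -- and the result is the message, which becomes part of the factor of `u`.
  process-invariant : ∀ {σ σ′} → Process G r σ σ′ → MessageInvariant σ → MessageInvariant σ′
  process-invariant (process {σ} {v} {u} vu v∉pr received) minv = record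
    { scopes = scopes′
    ; closed = λ v′∈ wv′ → p⊆p∪q ⁅ v ⁆ (closed′ v′∈ wv′)
    ; root∉  = λ r∈ → [ root∉ minv , r∉⁅v⁆ ]′ (x∈p∪q⁻ pr ⁅ v ⁆ r∈)
    ; remaining-total = subst (λ R → HasTotal R cur′ N) (p─q─r≡p─q∪r V pr ⁅ v ⁆) total′
    }
    where
    pr  = processed σ
    cur = current σ
    R   = V ─ pr
    R′  = R - v
    Xᵥ  = scope (cur v)
    Xᵤ  = scope (cur u)
    Z   = Xᵥ ─ Xᵤ
    cur′ = updateAt cur u (_⊗ message (cur v) (cur u))

    v-u : v ∈ V × u ∈ V × v ≢ u × Shared ts v u
    v-u = adjacent⁻ inv (parent⇒adjacent vu)
    v∈V = proj₁ v-u
    u∈V = proj₁ (proj₂ v-u)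
    v≢u = proj₁ (proj₂ (proj₂ v-u))

    v∈R : v ∈ R
    v∈R = x∈p∧x∉q⇒x∈p─q v∈V v∉pr

    u∈R′ : u ∈ R′
    -- Had `u` been processed, its child `v` would have been processed too.
    u∈R′ = x∈p∧x≢y⇒x∈p-y
      (x∈p∧x∉q⇒x∈p─q u∈V (λ u∈pr → v∉pr (closed minv u∈pr vu))) (v≢u ∘ sym)

    r∉⁅v⁆ : r ∉ ⁅ v ⁆
    r∉⁅v⁆ r∈⁅v⁆ with refl ← x∈⁅y⁆⇒x≡y v r∈⁅v⁆ = root-has-no-parent vu

    closed′ : ∀ {v′ w} → v′ ∈ pr ∪ ⁅ v ⁆ → Parent G r w v′ → w ∈ pr
    closed′ v′∈ wv′ with x∈p∪q⁻ pr ⁅ v ⁆ v′∈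
    ... | inj₁ v′∈pr = closed minv v′∈pr wv′
    ... | inj₂ v′∈⁅v⁆ with refl ← x∈⁅y⁆⇒x≡y v v′∈⁅v⁆ = received wv′

    -- By the choice of `Z` the message speaks only about variables common to `v` and `u`, so it
    -- does not enlarge the scope of `u`.
    scope-message : Xᵤ ∪ (Xᵥ ─ Z) ≡ Xᵤ
    scope-message = ⊆-antisym
      (λ x∈ → [ id , message⊆u ]′ (x∈p∪q⁻ Xᵤ (Xᵥ ─ Z) x∈))
      (p⊆p∪q (Xᵥ ─ Z))
      where
      message⊆u : Xᵥ ─ Z ⊆ Xᵤ
      message⊆u {x} x∈ with x ∈? Xᵤ
      ... | yes x∈Xᵤ = x∈Xᵤ
      ... | no  x∉Xᵤ = contradiction
        (x∈p∧x∉q⇒x∈p─q (p─q⊆p Xᵥ Z x∈) x∉Xᵤ) (x∈p─q⇒x∉q Xᵥ Z x∈)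

    cur′-scope : ∀ k → scope (cur′ k) ≡ scope (cur k)
    cur′-scope k with k Fin.≟ u
    ... | yes refl = trans (cong scope (updateAt-updates u cur)) scope-message
    ... | no  k≢u  = cong scope (updateAt-minimal k u cur k≢u)

    scopes′ : ∀ k → scope (cur′ k) ≡ scope (ts k)
    scopes′ k = trans (cur′-scope k) (scopes minv k)

    -- Every other remaining vertex that shares a variable with v is its parent u,
    -- as the children of v have been processed.
    separate : ∀ {k x} → k ∈ R′ → x ∈ scope (cur k) → x ∉ Z
    separate {k} {x} k∈R′ x∈k x∈Z
      with neighbour-of-child vu (adjacent⁺ inv k∈V v∈V (x∈p-y⇒x≢y R k∈R′)
             (x , subst (x ∈_) (scopes minv k) x∈k
                , subst (x ∈_) (scopes minv v) (p─q⊆p Xᵥ Xᵤ x∈Z)))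
      where k∈V = p─q⊆p V pr (p─q⊆p R ⁅ v ⁆ k∈R′)
    ... | inj₁ refl = x∈p─q⇒x∉q Xᵥ Xᵤ x∈Z x∈k
    ... | inj₂ kv   = x∈p─q⇒x∉q V pr (p─q⊆p R ⁅ v ⁆ k∈R′) (received kv)

    weight-cur′ : ∀ w → weight R′ cur′ w ≡ weight R′ cur w * ∑ Z ⟦ cur v ⟧ w
    weight-cur′ w = begin
      weight R′ cur′ w
        ≡⟨ ∏-extract u∈R′ _ ⟩
      weight (R′ - u) cur′ w * ⟦ cur′ u ⟧ w
        ≡⟨ cong₂ _*_
             (weight-updateAt cur _ w (x∈p-y⇒x≢y R′))
             (trans (cong (λ T → ⟦ T ⟧ w) (updateAt-updates u cur))
                    (⟦⊗⟧ (cur u) (message (cur v) (cur u)) w)) ⟩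
      weight (R′ - u) cur w * (⟦ cur u ⟧ w * ⟦ message (cur v) (cur u) ⟧ w)
        ≡⟨ sym (ℕ.*-assoc (weight (R′ - u) cur w) _ _) ⟩
      weight (R′ - u) cur w * ⟦ cur u ⟧ w * ⟦ message (cur v) (cur u) ⟧ w
        ≡⟨ cong₂ _*_ (sym (∏-extract u∈R′ _)) (⟦marginalize⟧ Z (cur v) (p─q⊆p Xᵥ Xᵤ) w) ⟩
      weight R′ cur w * ∑ Z ⟦ cur v ⟧ w ∎

    total′ : HasTotal R′ cur′ N
    total′ {U} union w = begin
      ∑ U (weight R′ cur′) w
        ≡⟨ ∑-cong U weight-cur′ w ⟩
      ∑ U (λ w → weight R′ cur w * ∑ Z ⟦ cur v ⟧ w) w
        ≡⟨ sym (∑-eliminate U Z disjoint (weight-independent R′ cur separate) ⟦ cur v ⟧ w) ⟩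
      ∑ (U ∪ Z) (λ w → weight R′ cur w * ⟦ cur v ⟧ w) w
        ≡⟨ ∑-cong (U ∪ Z) (λ w → sym (∏-extract v∈R _)) w ⟩
      ∑ (U ∪ Z) (weight R cur) w
        ≡⟨ remaining-total minv union′ w ⟩
      N ∎
      where
      locate′ : ∀ {x} → x ∈ U → ∃[ k ] k ∈ R′ × x ∈ scope (cur k)
      locate′ {x} x∈U = let (k , k∈R′ , x∈k) = locate union x∈U in
                        k , k∈R′ , subst (x ∈_) (cur′-scope k) x∈k

      cover′ : ∀ {x k} → k ∈ R′ → x ∈ scope (cur k) → x ∈ U
      cover′ {x} {k} k∈R′ x∈k = cover union k∈R′ (subst (x ∈_) (sym (cur′-scope k)) x∈k)

      disjoint : ∀ {x} → x ∈ U → x ∉ Z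
      disjoint x∈U = let (_ , k∈R′ , x∈k) = locate′ x∈U in separate k∈R′ x∈k

      union′ : IsScopeUnion R cur (U ∪ Z)
      union′ .locate x∈ with x∈p∪q⁻ U Z x∈
      ... | inj₁ x∈U = let (k , k∈R′ , x∈k) = locate′ x∈U in k , p─q⊆p R ⁅ v ⁆ k∈R′ , x∈k
      ... | inj₂ x∈Z = v , v∈R , p─q⊆p Xᵥ Xᵤ x∈Z
      union′ .cover {x} {k} k∈R x∈k with k Fin.≟ v | x ∈? Xᵤ
      ... | no  k≢v  | _        = p⊆p∪q Z (cover′ (x∈p∧x≢y⇒x∈p-y k∈R k≢v) x∈k)
      -- Variables of `v` shared with `u` remain covered by `u`; the others are exactly `Z`.
      ... | yes refl | yes x∈Xᵤ = p⊆p∪q Z (cover′ u∈R′ x∈Xᵤ)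
      ... | yes refl | no  x∉Xᵤ = q⊆p∪q U Z (x∈p∧x∉q⇒x∈p─q x∈k x∉Xᵤ)

  run-invariant : ∀ {σ σ′} → Star (Process G r) σ σ′ → MessageInvariant σ → MessageInvariant σ′
  run-invariant ε         minv = minv
  run-invariant (s ◅ run) minv = run-invariant run (process-invariant s minv)

  module _ {σ : MessageState n P} (minv : MessageInvariant σ) (received : ReceivedAll G r r σ) where

    private
      T = current σ r
      R = V ─ processed σ

    -- Induction from the root end of the path: on termination the children of the root are
    -- processed, and `closed` carries this from each parent to its child.
    processed-unless-root : ∀ {v} ws → SimplePath (Adjacent G) v ws r → v ≡ r ⊎ v ∈ processed σ
    processed-unless-root []       (_ , _ , last≡) = inj₁ (just-injective last≡)
    processed-unless-root (u ∷ ws) (linked@(_ ∷ linked′) , unique@(_ ∷ unique′) , last≡)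
      with processed-unless-root ws (linked′ , unique′ , last≡)
    ... | inj₁ refl = inj₂ (received (ws , linked , unique , last≡))
    ... | inj₂ u∈pr = inj₂ (closed minv u∈pr (ws , linked , unique , last≡))

    only-root-remains : ∀ {v} → v ∈ R → v ≡ r
    only-root-remains v∈R with ws , path ← simplePath (connected (p─q⊆p V (processed σ) v∈R) r∈V)
      with processed-unless-root ws path
    ... | inj₁ v≡r  = v≡r
    ... | inj₂ v∈pr = contradiction v∈pr (x∈p─q⇒x∉q V (processed σ) v∈R)

    root∈R : r ∈ R
    root∈R = x∈p∧x∉q⇒x∈p─q r∈V (root∉ minv)

    root-weight : ∀ w → weight R (current σ) w ≡ ⟦ T ⟧ w
    root-weight w = begin
      weight R (current σ) w                   ≡⟨ ∏-extract root∈R _ ⟩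
      weight (R - r) (current σ) w * ⟦ T ⟧ w   ≡⟨ cong (_* ⟦ T ⟧ w) (∏-one (R - r) λ k∈ →
        contradiction (only-root-remains (p─q⊆p R ⁅ r ⁆ k∈)) (x∈p-y⇒x≢y R k∈)) ⟩
      1 * ⟦ T ⟧ w                              ≡⟨ ℕ.*-identityˡ (⟦ T ⟧ w) ⟩
      ⟦ T ⟧ w                                  ∎

    root-union : IsScopeUnion R (current σ) (scope T)
    root-union .locate x∈T = r , root∈R , x∈T
    root-union .cover k∈R x∈k with refl ← only-root-remains k∈R = x∈k

    root-total : sum (map (count T) (entries T)) ≡ N
    root-total = begin
      sum (map (count T) (entries T))           ≡⟨ sum-entries T w ⟩
      ∑ (scope T) ⟦ T ⟧ w                     ≡⟨ ∑-cong (scope T) (sym ∘ root-weight) w ⟩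
      ∑ (scope T) (weight R (current σ)) w    ≡⟨ remaining-total minv root-union w ⟩
      N                                         ∎
      -- An arbitrary base valuation; the totals do not depend on it.
      where w = replicate n false

theorem6 : ∀ {n P : ℕ} (errorBits : Subset n) (F : CNF n) (parts : Vector (CNF n) P) →
    PartitionedInto F parts →
    (G : Graph n P) → Operations errorBits (initial parts) G → IsTree G →
    (r : Fin P) → r ∈ vertices G →
    (σ : MessageState n P) → TerminatesIn G r σ →
    satCount F ≡ sum (map (count (current σ r)) (entries (current σ r)))
theorem6 errorBits F parts partition G ops tree r r∈V σ (run , received) =
  sym (root-total inv tree r r∈V final received)
  where
  inv : Invariant (satCount F) G
  inv = operations-invariant ops (initial-invariant partition)
  final : MessageInvariant inv tree r r∈V σ
  final = run-invariant inv tree r r∈V run (start-invariant inv tree r r∈V)
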